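{- For each positive integer $k$, there exists a finite digraph $D$ with stability number $k$ such that for any $k-1$ directed paths $P_1,\ldots,P_{k-1}$ in $D$, the digraph obtained from $D$ by deleting all vertices of $P_1\cup\cdots\cup P_{k-1}$ has stability number $k$.
   Context: The stability number of a digraph is the maximum size of a set of vertices no two of which are joined by an edge (in either direction). A directed path is a sequence of distinct vertices $v_1,\ldots,v_m$ ($m\ge 1$) with an edge from $v_i$ to $v_{i+1}$ for each $i$. -}

module Defs where

open import Data.Fin using (Fin)
open import Data.Fin.Subset using (Subset; _∈_; _⊆_; _─_; ∣_∣; ⁅_⁆; ⋃)
open import Data.List using (List; []; map)
open import Data.List.Relation.Unary.All using (All)
open import Data.List.Relation.Unary.Linked using (Linked)
open import Data.List.Relation.Unary.Unique.Propositional using (Unique)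
open import Data.Nat using (ℕ; _≤_)
open import Data.Product using (∃; _×_; _,_; proj₁)
open import Data.Sum using (_⊎_)
open import Data.Vec using (Vec; toList)
open import Level using (0ℓ)
open import Relation.Binary.Core using (Rel)
open import Relation.Binary.Definitions using (Decidable; Irreflexive)
open import Relation.Binary.PropositionalEquality using (_≡_; _≢_)
open import Relation.Nullary using (¬_)
open import Relation.Nullary.Decidable using (_×-dec_)
open import Data.Fin.Subset.Properties using (_∈?_)

-- The vertex set is a subset of an ambient Fin n, rather than Fin n itself, so
-- that deleting vertices gives a digraph without renumbering.  Loops are
-- excluded; a pair of opposite edges is allowed.
record Digraph (n : ℕ) : Set₁ where
  field
    V        : Subset n
    Edge     : Rel (Fin n) 0ℓ
    edge?    : Decidable Edge
    edge⇒∈   : ∀ {u v} → Edge u v → u ∈ V × v ∈ V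
    loopless : Irreflexive _≡_ Edge

open Digraph public

infixl 5 _∖_

_∖_ : ∀ {n} → Digraph n → Subset n → Digraph n
D ∖ X = record
  { V        = V D ─ X
  ; Edge     = λ u v → Edge D u v × (u ∈ V D ─ X × v ∈ V D ─ X)
  ; edge?    = λ u v → edge? D u v ×-dec ((u ∈? V D ─ X) ×-dec (v ∈? V D ─ X))
  ; edge⇒∈   = λ (_ , uv∈) → uv∈
  ; loopless = λ u≡v e → loopless D u≡v (proj₁ e)
  }

Stable : ∀ {n} → Digraph n → Subset n → Set
Stable D S =
  S ⊆ V D ×
  (∀ u v → u ∈ S → v ∈ S → u ≢ v → ¬ (Edge D u v ⊎ Edge D v u))

HasStabilityNumber : ∀ {n} → Digraph n → ℕ → Set
HasStabilityNumber D k =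
  (∃ λ S → Stable D S × ∣ S ∣ ≡ k) ×
  (∀ S → Stable D S → ∣ S ∣ ≤ k)

record DirectedPath {n : ℕ} (D : Digraph n) : Set where
  field
    vertices : List (Fin n)
    nonempty : vertices ≢ []
    inside   : All (_∈ V D) vertices
    distinct : Unique vertices
    linked   : Linked (Edge D) vertices

open DirectedPath public

pathVertices : ∀ {n} {D : Digraph n} → DirectedPath D → Subset n
pathVertices P = ⋃ (map ⁅_⁆ (vertices P))

unionVertices : ∀ {n m} {D : Digraph n} → Vec (DirectedPath D) m → Subset n
unionVertices Ps = ⋃ (map pathVertices (toList Ps))

-- The idea is to find a K_{k+1}-free graph H such that every k-colouring of its
-- vertices has a monochromatic K_k (Folkman), and to place its vertices in
-- order as rows of k points each.  Two points are made non-adjacent in D when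
-- they share a row, or share a column while their rows are adjacent in H; all
-- other pairs are joined by an edge towards the later row.  Stable sets of D
-- are the cliques of the Cartesian product of H and K_k, so they have at most
-- k points.  A path meets each row at most once, hence k − 1 paths miss some
-- point of every row; its column colours the row, and a monochromatic K_k in H
-- is a surviving stable set of size k.
--
-- H comes from a double induction on the number of colours and the clique
-- size.  Given F for r colours and K_{k+1}, and F′ for r + 1 colours and K_k,
-- take many disjoint copies of F′, and for each choice J of a copy of F′ for
-- every vertex of F a new copy of F, with v joined to all of the J v-th copy of
-- F′.  Among enough copies of F′, |F| of them have a monochromatic K_k of the
-- same colour; let J select these.  Either that colour occurs in the J-th copy
-- of F and extends one of these K_k, or that copy uses only r colours.

module Submission where

open import Defs
open import Data.Bool using (true; false)
open import Data.Empty using (⊥)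
open import Data.Fin using (Fin; zero; suc; _<_; remQuot; punchIn; punchOut; quotient; combine; finToFun; funToFin)
open import Data.Fin.Properties using (_≟_; _<?_; <-cmp; any?; pigeonhole; punchIn-punchOut; remQuot-combine; combine-remQuot; combine-injectiveˡ; combine-injectiveʳ; finToFun-funToFin; +↔⊎; *↔×; ¬∀⟶∃¬)
import Data.Fin.Properties as Fin
open import Data.Fin.Subset using (Subset; _∈_; _∉_; _∪_; ∣_∣; ⁅_⁆; ⋃; ⊤) renaming (⊥ to ∅)
open import Data.Fin.Subset.Properties using (_∈?_; ∈⊤; ∉⊥; x∈⁅y⁆⇒x≡y; x∈p∪q⁻; ∣⊥∣≡0; ∣p∣≤n; x∈p∧x∉q⇒x∈p─q; ∪-identityˡ)
open import Data.List using (List; []; _∷_; _++_; map; length)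
open import Data.List.Membership.Propositional using () renaming (_∈_ to _∈ₗ_)
open import Data.List.Membership.Propositional.Properties using (∈-AllPairs₂)
open import Data.List.Properties using (length-map; length-++)
open import Data.List.Relation.Binary.Permutation.Propositional using (_↭_; ↭-refl; ↭-trans; ↭-sym; prep; ↭⇒↭ₛ)
open import Data.List.Relation.Binary.Permutation.Propositional.Properties using (shift; ↭-length)
open import Data.List.Relation.Binary.Permutation.Setoid.Properties using (AllPairs-resp-↭)
open import Data.List.Relation.Unary.All as All using (All; []; _∷_)
import Data.List.Relation.Unary.All.Properties as All
open import Data.List.Relation.Unary.AllPairs as AllPairs using (AllPairs; []; _∷_)
import Data.List.Relation.Unary.AllPairs.Properties as AllPairs
open import Data.List.Relation.Unary.Any using (here; there)
import Data.List.Relation.Unary.Linked as Linked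
open import Data.List.Relation.Unary.Linked.Properties using (Linked⇒AllPairs)
open import Data.List.Relation.Unary.Unique.Propositional using (Unique)
import Data.List.Relation.Unary.Unique.Propositional.Properties as Unique
open import Data.Nat using (ℕ; zero; suc; _+_; _*_; _^_; _∸_; _≤_; z≤n; s≤s; NonZero)
open import Data.Nat.Properties using (m≤n⇒m≤1+n; +-identityʳ; n<1+n; module ≤-Reasoning)
open import Data.Product using (Σ; ∃; ∃₂; _×_; _,_; proj₁; proj₂)
open import Data.Sum using (_⊎_; inj₁; inj₂)
open import Data.Sum.Function.Propositional using (_⊎-↔_)
open import Data.Vec using (Vec; []; _∷_; here; there; lookup)
open import Function using (_∘_; _on_; _↔_; Inverse)
open import Function.Construct.Composition using (_↔-∘_)
open import Function.Definitions using (Injective)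
open import Level using (0ℓ)
open import Relation.Binary using (Rel; Symmetric; Decidable; tri<; tri≈; tri>)
open import Relation.Binary.PropositionalEquality using (_≡_; _≢_; refl; sym; trans; cong; cong₂; subst; subst₂; setoid; resp₂)
open import Relation.Nullary using (¬_; yes; no; contradiction)
open import Relation.Nullary.Decidable using (_×-dec_; _⊎-dec_; ¬?; decidable-stable)

-- Graphs, cliques and colourings

record Graph (V : Set) : Set₁ where
  field
    Adj    : Rel V 0ℓ
    adj?   : Decidable Adj
    symm   : Symmetric Adj
    irrefl : ∀ {v} → ¬ Adj v v

open Graph

-- As `Adj` is irreflexive, such a list has no repetitions and its length is the size of the clique.
Clique : ∀ {V} → Graph V → List V → Set
Clique G = AllPairs (Adj G)

CliqueBounded : ∀ {V} → Graph V → ℕ → Set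
CliqueBounded G k = ∀ xs → Clique G xs → length xs ≤ k

MonoClique : ∀ {V r} → Graph V → (V → Fin r) → ℕ → Set
MonoClique G f k = ∃₂ λ c xs → length xs ≡ k × Clique G xs × All (λ x → f x ≡ c) xs

Arrows : ∀ {V} → Graph V → ℕ → ℕ → Set
Arrows {V} G r k = (f : V → Fin r) → MonoClique G f k

pullback : ∀ {V W} → (W → V) → Graph V → Graph W
pullback d G = record
  { Adj    = Adj G on d
  ; adj?   = λ x y → adj? G (d x) (d y)
  ; symm   = symm G
  ; irrefl = irrefl G
  }

pullback-cliqueBounded : ∀ {V W} (d : W → V) (G : Graph V) {k} →
  CliqueBounded G k → CliqueBounded (pullback d G) k
pullback-cliqueBounded d G b xs cl =
  subst (_≤ _) (length-map d xs) (b (map d xs) (AllPairs.map⁺ cl))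

pullback-arrows : ∀ {V W} (i : W ↔ V) (G : Graph V) {r k} →
  Arrows G r k → Arrows (pullback (Inverse.to i) G) r k
pullback-arrows i G a f with a (f ∘ Inverse.from i)
... | c , xs , len , cl , mono =
  c , map from xs , trans (length-map from xs) len ,
  AllPairs.map⁺ (AllPairs.map (λ {x} {y} → subst₂ (Adj G) (sym (inv x)) (sym (inv y))) cl) ,
  All.map⁺ mono
  where
  open Inverse i using (from) renaming (strictlyInverseˡ to inv)

AllPairs-++⁻ : ∀ {A : Set} {R : Rel A 0ℓ} xs {ys} → AllPairs R (xs ++ ys) →
  AllPairs R xs × AllPairs R ys × All (λ x → All (R x) ys) xs
AllPairs-++⁻ []       ps       = [] , ps , []
AllPairs-++⁻ (x ∷ xs) (p ∷ ps) with AllPairs-++⁻ xs ps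
... | pxs , pys , cross = All.++⁻ˡ xs p ∷ pxs , pys , All.++⁻ʳ xs p ∷ cross

-- Cliques survive reordering, so a clique of the amalgam can be sorted into its part in copies of
-- `F` and its part in copies of `F′`.
split-⊎ : ∀ {A B : Set} (xs : List (A ⊎ B)) →
  ∃₂ λ ys zs → xs ↭ map inj₁ ys ++ map inj₂ zs
split-⊎ [] = [] , [] , ↭-refl
split-⊎ (inj₁ y ∷ xs) with split-⊎ xs
... | ys , zs , p = y ∷ ys , zs , prep _ p
split-⊎ (inj₂ z ∷ xs) with split-⊎ xs
... | ys , zs , p = ys , z ∷ zs , ↭-trans (prep _ p) (↭-sym (shift _ (map inj₁ ys) (map inj₂ zs)))

-- Either every a has some x with combine a x of colour zero, or the row of some
-- a avoids colour zero.
monochromatic-injection : ∀ n r → ∃ λ b → (f : Fin b → Fin r) →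
  ∃₂ λ (c : Fin r) (J : Fin n → Fin b) → Injective _≡_ _≡_ J × (∀ v → f (J v) ≡ c)
monochromatic-injection n zero    = 1 , λ f → contradiction (f zero) λ ()
monochromatic-injection n (suc r) with monochromatic-injection n r
... | b , ih = n * b , found
  where
  found : (f : Fin (n * b) → Fin (suc r)) → ∃₂ λ c J → Injective _≡_ _≡_ J × (∀ v → f (J v) ≡ c)
  found f with Fin.all? (λ a → any? (λ x → f (combine a x) ≟ zero))
  ... | yes hit = zero , (λ a → combine a (proj₁ (hit a))) ,
                  (λ {a} {a′} → combine-injectiveˡ a _ a′ _) , (λ a → proj₂ (hit a))
  ... | no ¬hit with ¬∀⟶∃¬ n _ (λ a → any? (λ x → f (combine a x) ≟ zero)) ¬hit
  -- Colour zero can be punched out on this row, which leaves a colouring of `Fin b` with `r`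
  -- colours.
  ... | a , miss with ih (λ x → punchOut (λ eq → miss (x , sym eq)))
  ... | c , J , inj , mono = suc c , combine a ∘ J , (λ {v} {w} eq → inj (combine-injectiveʳ a _ a _ eq)) ,
        λ v → trans (sym (punchIn-punchOut (λ eq → miss (J v , sym eq)))) (cong suc (mono v))

-- Folkman graphs by amalgamation

module Amalgam {n m b : ℕ} (F : Graph (Fin n)) (F′ : Graph (Fin m)) where

  -- An index in `Fin (b ^ n)` encodes, through `finToFun`, a choice of one of the `b` copies of
  -- `F′` for each vertex of `F`.
  Vertex : Set
  Vertex = (Fin (b ^ n) × Fin n) ⊎ (Fin b × Fin m)

  -- J ranges over all maps, so an edge v w of F is dropped from the J-th copy
  -- when J v ≡ J w; otherwise it could form a clique of size k + 2 with F′.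
  adj : Rel Vertex 0ℓ
  adj (inj₁ (J , v)) (inj₁ (K , w)) = J ≡ K × Adj F v w × finToFun J v ≢ finToFun J w
  adj (inj₁ (J , v)) (inj₂ (j , _)) = finToFun J v ≡ j
  adj (inj₂ (j , _)) (inj₁ (J , v)) = finToFun J v ≡ j
  adj (inj₂ (i , x)) (inj₂ (j , y)) = i ≡ j × Adj F′ x y

  adj-dec : Decidable adj
  adj-dec (inj₁ (J , v)) (inj₁ (K , w)) = (J ≟ K) ×-dec (adj? F v w ×-dec ¬? (finToFun J v ≟ finToFun J w))
  adj-dec (inj₁ (J , v)) (inj₂ (j , _)) = finToFun J v ≟ j
  adj-dec (inj₂ (j , _)) (inj₁ (J , v)) = finToFun J v ≟ j
  adj-dec (inj₂ (i , x)) (inj₂ (j , y)) = (i ≟ j) ×-dec adj? F′ x y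

  adj-sym : Symmetric adj
  adj-sym {inj₁ _} {inj₁ _} (refl , a , ne) = refl , symm F a , ne ∘ sym
  adj-sym {inj₁ _} {inj₂ _} e               = e
  adj-sym {inj₂ _} {inj₁ _} e               = e
  adj-sym {inj₂ _} {inj₂ _} (refl , a)      = refl , symm F′ a

  adj-irrefl : ∀ {v} → ¬ adj v v
  adj-irrefl {inj₁ _} (_ , _ , ne) = ne refl
  adj-irrefl {inj₂ _} (_ , a)      = irrefl F′ a

  amalgam : Graph Vertex
  amalgam = record { Adj = adj ; adj? = adj-dec ; symm = λ {x} → adj-sym {x} ; irrefl = λ {v} → adj-irrefl {v} }

  -- Two adjacent vertices in a copy of `F` are joined to different copies of `F′`, so they have no
  -- common neighbour there. A clique thus has at most one vertex in `ys`, besides at most `k` in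
  -- `zs`, or it lies in a copy of `F`.
  parts-bounded : ∀ {k} → CliqueBounded F (suc k) → CliqueBounded F′ k → ∀ ys zs →
    AllPairs (adj on inj₁) ys → AllPairs (adj on inj₂) zs →
    All (λ y → All (λ z → adj (inj₁ y) (inj₂ z)) zs) ys →
    length ys + length zs ≤ suc k
  parts-bounded bF bF′ [] zs _ czs _ =
    m≤n⇒m≤1+n (pullback-cliqueBounded proj₂ F′ bF′ zs (AllPairs.map proj₂ czs))
  parts-bounded bF bF′ (y ∷ []) zs _ czs _ =
    s≤s (pullback-cliqueBounded proj₂ F′ bF′ zs (AllPairs.map proj₂ czs))
  parts-bounded bF bF′ ys@(_ ∷ _ ∷ _) [] cys _ _ rewrite +-identityʳ (length ys) =
    pullback-cliqueBounded proj₂ F bF ys (AllPairs.map (proj₁ ∘ proj₂) cys)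
  parts-bounded bF bF′ (_ ∷ _ ∷ _) (_ ∷ _) (((refl , _ , ne) ∷ _) ∷ _) _ ((e ∷ _) ∷ (e′ ∷ _) ∷ _) =
    contradiction (trans e (sym e′)) ne

  amalgam-cliqueBounded : ∀ {k} → CliqueBounded F (suc k) → CliqueBounded F′ k → CliqueBounded amalgam (suc k)
  amalgam-cliqueBounded bF bF′ xs cl with split-⊎ xs
  ... | ys , zs , p with AllPairs-++⁻ (map inj₁ ys)
                          (AllPairs-resp-↭ (setoid Vertex) (λ {x} → adj-sym {x}) (resp₂ adj) (↭⇒↭ₛ p) cl)
  ... | cys , czs , cross = begin
    length xs                             ≡⟨ ↭-length p ⟩
    length (map inj₁ ys ++ map inj₂ zs)   ≡⟨ length-++ (map inj₁ ys) ⟩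
    length (map inj₁ ys) + length (map inj₂ zs) ≡⟨ cong₂ _+_ (length-map inj₁ ys) (length-map inj₂ zs) ⟩
    length ys + length zs                 ≤⟨ parts-bounded bF bF′ ys zs (AllPairs.map⁻ cys) (AllPairs.map⁻ czs)
                                               (All.map All.map⁻ (All.map⁻ cross)) ⟩
    _ ∎
    where open ≤-Reasoning

  amalgam-arrows : ∀ {r k} →
    ((f : Fin b → Fin (suc r)) → ∃₂ λ c (J : Fin n → Fin b) → Injective _≡_ _≡_ J × (∀ v → f (J v) ≡ c)) →
    Arrows F r (suc k) → Arrows F′ (suc r) k → Arrows amalgam (suc r) (suc k)
  -- Each copy of `F′` is coloured by the colour of the monochromatic clique found in it.
  amalgam-arrows ram aF aF′ f with ram (λ j → proj₁ (aF′ (λ x → f (inj₂ (j , x)))))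
  ... | red , J , inj , isRed with any? (λ v → f (inj₁ (funToFin J , v)) ≟ red)
  -- The red clique in copy `J v` consists of neighbours of the red vertex `v`, which extends it.
  ... | yes (v , v-red) with aF′ (λ x → f (inj₂ (J v , x))) | isRed v
  ...   | _ , xs , len , cl , mono | refl =
    red , inj₁ (funToFin J , v) ∷ map (λ x → inj₂ (J v , x)) xs ,
    cong suc (trans (length-map _ xs) len) ,
    All.map⁺ (All.universal (λ _ → finToFun-funToFin J v) xs) ∷ AllPairs.map⁺ (AllPairs.map (refl ,_) cl) ,
    v-red ∷ All.map⁺ mono
  -- Punching out `red` leaves `r` colours on the copy of `F` indexed by `J`.
  amalgam-arrows ram aF aF′ f | red , J , inj , isRed | no no-red
    with aF (λ v → punchOut {i = red} (λ eq → no-red (v , sym eq)))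
  ... | c , xs , len , cl , mono =
    punchIn red c , map (λ v → inj₁ (funToFin J , v)) xs , trans (length-map _ xs) len ,
    AllPairs.map⁺ (AllPairs.map (λ a → refl , a , separated a) cl) ,
    All.map⁺ (All.map (λ eq → trans (sym (punchIn-punchOut _)) (cong (punchIn red) eq)) mono)
    where
    -- Since `J` is injective, its copy of `F` has lost no edge.
    separated : ∀ {v w} → Adj F v w → finToFun (funToFin J) v ≢ finToFun (funToFin J) w
    separated {v} {w} a eq
      with inj (trans (sym (finToFun-funToFin J v)) (trans eq (finToFun-funToFin J w)))
    ... | refl = irrefl F a

Folkman : ℕ → ℕ → Set₁
Folkman r k = ∃ λ n → Σ (Graph (Fin n)) λ G → CliqueBounded G k × Arrows G r k

folkman-step : ∀ {r k} → Folkman r (suc k) → Folkman (suc r) k → Folkman (suc r) (suc k)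
folkman-step {r} (n , F , bF , aF) (m , F′ , bF′ , aF′) with monochromatic-injection n (suc r)
... | b , ram = _ , pullback (Inverse.to i) amalgam ,
  pullback-cliqueBounded _ amalgam (amalgam-cliqueBounded bF bF′) ,
  pullback-arrows i amalgam (amalgam-arrows ram aF aF′)
  where
  open Amalgam {b = b} F F′
  i : Fin (b ^ n * n + b * m) ↔ Vertex
  i = (*↔× ⊎-↔ *↔×) ↔-∘ +↔⊎

edgeless : ∀ n → Graph (Fin n)
edgeless n = record { Adj = λ _ _ → ⊥ ; adj? = λ _ _ → no λ () ; symm = λ () ; irrefl = λ () }

-- The clique size starts at one because `Folkman 0 0` is false: its graph would have no vertices,
-- hence a colouring, while `MonoClique` has to name a colour.
folkman : ∀ r k → Folkman r (suc k)
-- A single vertex cannot be coloured with zero colours, so the arrow is vacuous.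
folkman zero    k       = 1 , edgeless 1 , bounded , λ f → contradiction (f zero) λ ()
  where
  bounded : CliqueBounded (edgeless 1) (suc k)
  bounded []          _              = z≤n
  bounded (_ ∷ [])    _              = s≤s z≤n
  bounded (_ ∷ _ ∷ _) ((() ∷ _) ∷ _)
-- For clique size zero the empty graph serves as `F′`, with the empty list as monochromatic clique.
folkman (suc r) zero    = folkman-step (folkman r zero)
  (0 , edgeless 0 , (λ { [] _ → z≤n }) , λ _ → zero , [] , refl , [] , [])
folkman (suc r) (suc k) = folkman-step (folkman r (suc k)) (folkman (suc r) k)


-- Translation between subsets and lists without repetitions

∈-⋃-map⁻ : ∀ {A : Set} {n} (g : A → Subset n) xs {v} → v ∈ ⋃ (map g xs) → ∃ λ x → x ∈ₗ xs × v ∈ g x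
∈-⋃-map⁻ g []       v∈ = contradiction v∈ ∉⊥
∈-⋃-map⁻ g (x ∷ xs) v∈ with x∈p∪q⁻ (g x) _ v∈
... | inj₁ v∈x  = x , here refl , v∈x
... | inj₂ v∈xs with ∈-⋃-map⁻ g xs v∈xs
...   | y , y∈xs , v∈y = y , there y∈xs , v∈y

∈-⋃-singletons⁻ : ∀ {n} (xs : List (Fin n)) {v} → v ∈ ⋃ (map ⁅_⁆ xs) → v ∈ₗ xs
∈-⋃-singletons⁻ xs v∈ with ∈-⋃-map⁻ ⁅_⁆ xs v∈
... | x , x∈xs , v∈x rewrite x∈⁅y⁆⇒x≡y x v∈x = x∈xs

∣⁅x⁆∪p∣ : ∀ {n} (x : Fin n) p → x ∉ p → ∣ ⁅ x ⁆ ∪ p ∣ ≡ suc ∣ p ∣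
∣⁅x⁆∪p∣ zero    (true  ∷ p) x∉p = contradiction here x∉p
∣⁅x⁆∪p∣ zero    (false ∷ p) _   = cong (suc ∘ ∣_∣) (∪-identityˡ p)
∣⁅x⁆∪p∣ (suc x) (true  ∷ p) x∉p = cong suc (∣⁅x⁆∪p∣ x p (x∉p ∘ there))
∣⁅x⁆∪p∣ (suc x) (false ∷ p) x∉p = ∣⁅x⁆∪p∣ x p (x∉p ∘ there)

∣⋃-singletons∣ : ∀ {n} {xs : List (Fin n)} → Unique xs → ∣ ⋃ (map ⁅_⁆ xs) ∣ ≡ length xs
∣⋃-singletons∣ {n} {[]}    []        = ∣⊥∣≡0 n
∣⋃-singletons∣ {xs = x ∷ xs} (x∉ ∷ u) =
  trans (∣⁅x⁆∪p∣ x _ (λ x∈ → All.lookup x∉ (∈-⋃-singletons⁻ xs x∈) refl)) (cong suc (∣⋃-singletons∣ u))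

elements : ∀ {n} → Subset n → List (Fin n)
elements []          = []
elements (true  ∷ p) = zero ∷ map suc (elements p)
elements (false ∷ p) = map suc (elements p)

length-elements : ∀ {n} (p : Subset n) → length (elements p) ≡ ∣ p ∣
length-elements []          = refl
length-elements (true  ∷ p) = cong suc (trans (length-map suc (elements p)) (length-elements p))
length-elements (false ∷ p) = trans (length-map suc (elements p)) (length-elements p)

elements-pairs : ∀ {n} (p : Subset n) {R : Rel (Fin n) 0ℓ} →
  (∀ {u v} → u ∈ p → v ∈ p → u ≢ v → R u v) → AllPairs R (elements p)
elements-pairs p {R} r = go (elements p) (unique p) (members p)
  where
  unique : ∀ {n} (p : Subset n) → Unique (elements p)
  unique []          = []
  unique (true  ∷ p) = All.map⁺ (All.universal (λ _ ()) _) ∷ Unique.map⁺ Fin.suc-injective (unique p)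
  unique (false ∷ p) = Unique.map⁺ Fin.suc-injective (unique p)

  members : ∀ {n} (p : Subset n) → All (_∈ p) (elements p)
  members []          = []
  members (true  ∷ p) = here ∷ All.map⁺ (All.map there (members p))
  members (false ∷ p) = All.map⁺ (All.map there (members p))

  go : ∀ xs → Unique xs → All (_∈ p) xs → AllPairs R xs
  go []       _        _          = []
  go (x ∷ xs) (x∉ ∷ u) (x∈ ∷ xs∈) =
    All.zipWith (λ (ne , y∈) → r x∈ y∈ ne) (x∉ , xs∈) ∷ go xs u xs∈

clique⇒unique : ∀ {V} (G : Graph V) {xs} → Clique G xs → Unique xs
clique⇒unique G = AllPairs.map λ { a refl → irrefl G a }

-- Cliques of the Cartesian product of a graph and a complete graph

prism : ∀ {t k} → Graph (Fin t) → Graph (Fin t × Fin k)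
prism H = record
  { Adj    = λ (i , c) (j , d) → (i ≡ j × c ≢ d) ⊎ (c ≡ d × Adj H i j)
  ; adj?   = λ (i , c) (j , d) → ((i ≟ j) ×-dec ¬? (c ≟ d)) ⊎-dec ((c ≟ d) ×-dec adj? H i j)
  ; symm   = λ { (inj₁ (eq , ne)) → inj₁ (sym eq , ne ∘ sym) ; (inj₂ (eq , a)) → inj₂ (sym eq , symm H a) }
  ; irrefl = λ { (inj₁ (_ , ne)) → ne refl ; (inj₂ (_ , a)) → irrefl H a }
  }

-- The first two entries differ in exactly one coordinate. An entry adjacent to both must share
-- their common coordinate, so the whole clique lies in one row, where columns are distinct, or in
-- one column, which is a copy of `H`.
prism-line : ∀ {t k} (H : Graph (Fin t)) {xs : List (Fin t × Fin k)} → Clique (prism H) xs →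
  Unique (map proj₂ xs) ⊎ Clique H (map proj₁ xs)
prism-line H []        = inj₁ []
prism-line H ([] ∷ []) = inj₁ ([] ∷ [])
prism-line {t} {k} H cl@((inj₁ (refl , ne) ∷ px) ∷ py ∷ _) =
  inj₁ (AllPairs.map⁺ (pairs cl (refl ∷ refl ∷ All.zipWith inRow (px , py))))
  where
  inRow : ∀ {z} → Adj (prism H) _ z × Adj (prism H) _ z → proj₁ z ≡ _
  inRow (inj₁ (refl , _) , _)               = refl
  inRow (inj₂ _          , inj₁ (refl , _)) = refl
  inRow (inj₂ (refl , _) , inj₂ (refl , _)) = contradiction refl ne

  pairs : ∀ {i} {xs : List (Fin t × Fin k)} → Clique (prism H) xs → All (λ z → proj₁ z ≡ i) xs → AllPairs (_≢_ on proj₂) xs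
  pairs []       []           = []
  pairs (p ∷ ps) (refl ∷ eqs) = All.zipWith differ (p , eqs) ∷ pairs ps eqs
    where
    differ : ∀ {z} → Adj (prism H) _ z × proj₁ z ≡ _ → _ ≢ proj₂ z
    differ (inj₁ (_ , ne) , _)    = ne
    differ (inj₂ (_ , a)  , refl) = contradiction a (irrefl H)
prism-line {t} {k} H cl@((inj₂ (refl , a) ∷ px) ∷ py ∷ _) =
  inj₂ (AllPairs.map⁺ (pairs cl (refl ∷ refl ∷ All.zipWith inColumn (px , py))))
  where
  inColumn : ∀ {z} → Adj (prism H) _ z × Adj (prism H) _ z → proj₂ z ≡ _
  inColumn (inj₂ (refl , _)  , _)                = refl
  inColumn (inj₁ _           , inj₂ (refl , _))  = refl
  inColumn (inj₁ (refl , _)  , inj₁ (refl , _))  = contradiction a (irrefl H)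

  pairs : ∀ {c} {xs : List (Fin t × Fin k)} → Clique (prism H) xs → All (λ z → proj₂ z ≡ c) xs → AllPairs (Adj H on proj₁) xs
  pairs []       []           = []
  pairs (p ∷ ps) (refl ∷ eqs) = All.zipWith adjacent (p , eqs) ∷ pairs ps eqs
    where
    adjacent : ∀ {z} → Adj (prism H) _ z × proj₂ z ≡ _ → Adj H _ (proj₁ z)
    adjacent (inj₁ (_ , ne) , refl) = contradiction refl ne
    adjacent (inj₂ (_ , b)  , _)    = b

prism-cliqueBounded : ∀ {t k} (H : Graph (Fin t)) → CliqueBounded H k → CliqueBounded (prism {k = k} H) k
prism-cliqueBounded {k = k} H b xs cl with prism-line H cl
... | inj₁ u   = subst (_≤ k) (trans (∣⋃-singletons∣ u) (length-map proj₂ xs)) (∣p∣≤n (⋃ (map ⁅_⁆ (map proj₂ xs))))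
... | inj₂ clH = subst (_≤ k) (length-map proj₁ xs) (b _ clH)

-- The layered digraph, its stable sets and its paths

module Layered {n t : ℕ} (G : Graph (Fin n)) (row : Fin n → Fin t)
               (row-clique : ∀ {u v} → row u ≡ row v → u ≢ v → Adj G u v) where

  -- Pairs in one row get no edge, and `row-clique` makes them adjacent in `G`; hence stable sets of
  -- `D` are exactly cliques of `G`.
  D : Digraph n
  D = record
    { V        = ⊤
    ; Edge     = λ u v → row u < row v × ¬ Adj G u v
    ; edge?    = λ u v → (row u <? row v) ×-dec ¬? (adj? G u v)
    ; edge⇒∈   = λ _ → ∈⊤ , ∈⊤
    ; loopless = λ { refl (lt , _) → Fin.<-irrefl refl lt }
    }

  stable⇒adj : ∀ {S u v} → Stable D S → u ∈ S → v ∈ S → u ≢ v → Adj G u v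
  stable⇒adj {u = u} {v} (_ , st) u∈ v∈ ne with <-cmp (row u) (row v)
  ... | tri< lt _ _ = decidable-stable (adj? G u v) λ ¬a → st u v u∈ v∈ ne (inj₁ (lt , ¬a))
  ... | tri≈ _ eq _ = row-clique eq ne
  ... | tri> _ _ gt = decidable-stable (adj? G u v) λ ¬a → st u v u∈ v∈ ne (inj₂ (gt , ¬a ∘ symm G))

  stable-bounded : ∀ {k} → CliqueBounded G k → ∀ S → Stable D S → ∣ S ∣ ≤ k
  stable-bounded b S st =
    subst (_≤ _) (length-elements S) (b _ (elements-pairs S (stable⇒adj st)))

  ∖-stable⇒stable : ∀ {X S} → Stable (D ∖ X) S → Stable D S
  ∖-stable⇒stable (S⊆ , st) = (λ _ → ∈⊤) , λ u v u∈ v∈ ne →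
    λ { (inj₁ e) → st u v u∈ v∈ ne (inj₁ (e , S⊆ u∈ , S⊆ v∈))
      ; (inj₂ e) → st u v u∈ v∈ ne (inj₂ (e , S⊆ v∈ , S⊆ u∈)) }

  clique⇒stable : ∀ {X xs} → Clique G xs → All (_∉ X) xs → Stable (D ∖ X) (⋃ (map ⁅_⁆ xs))
  clique⇒stable {X} {xs} cl avoid =
    (λ u∈ → x∈p∧x∉q⇒x∈p─q ∈⊤ (All.lookup avoid (∈-⋃-singletons⁻ xs u∈))) , independent
    where
    adjacent : ∀ {u v} → u ∈ ⋃ (map ⁅_⁆ xs) → v ∈ ⋃ (map ⁅_⁆ xs) → u ≢ v → Adj G u v
    adjacent u∈ v∈ ne with ∈-AllPairs₂ cl (∈-⋃-singletons⁻ xs u∈) (∈-⋃-singletons⁻ xs v∈)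
    ... | inj₁ eq       = contradiction eq ne
    ... | inj₂ (inj₁ a) = a
    ... | inj₂ (inj₂ a) = symm G a

    independent : ∀ u v → u ∈ ⋃ (map ⁅_⁆ xs) → v ∈ ⋃ (map ⁅_⁆ xs) → u ≢ v →
      ¬ (Edge (D ∖ X) u v ⊎ Edge (D ∖ X) v u)
    independent u v u∈ v∈ ne (inj₁ ((_ , ¬a) , _)) = ¬a (adjacent u∈ v∈ ne)
    independent u v u∈ v∈ ne (inj₂ ((_ , ¬a) , _)) = ¬a (symm G (adjacent u∈ v∈ ne))

  ∖-stabilityNumber : ∀ {k X} → CliqueBounded G k →
    (∃ λ xs → length xs ≡ k × Clique G xs × All (_∉ X) xs) → HasStabilityNumber (D ∖ X) k
  ∖-stabilityNumber b (xs , len , cl , avoid) =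
    (_ , clique⇒stable cl avoid , trans (∣⋃-singletons∣ (clique⇒unique G cl)) len) ,
    λ S st → stable-bounded b S (∖-stable⇒stable st)

  -- Applied to the deletion of the empty set, this settles `D` itself without identifying `D ∖ ∅`
  -- with `D`.
  ∖-stabilityNumber⇒ : ∀ {k X} → CliqueBounded G k → HasStabilityNumber (D ∖ X) k → HasStabilityNumber D k
  ∖-stabilityNumber⇒ b ((S , st , len) , _) = (S , ∖-stable⇒stable st , len) , stable-bounded b

  -- Every edge strictly increases the row, so by transitivity any two entries of the path lie in
  -- different rows.
  path-meets-row-once : (P : DirectedPath D) → ∀ {u v} → u ∈ pathVertices P → v ∈ pathVertices P →
    row u ≡ row v → u ≡ v
  path-meets-row-once P u∈ v∈ eq
    with ∈-AllPairs₂ (Linked⇒AllPairs Fin.<-trans (Linked.map proj₁ (linked P)))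
           (∈-⋃-singletons⁻ (vertices P) u∈) (∈-⋃-singletons⁻ (vertices P) v∈)
  ... | inj₁ u≡v       = u≡v
  ... | inj₂ (inj₁ lt) = contradiction lt (Fin.<-irrefl eq)
  ... | inj₂ (inj₂ gt) = contradiction gt (Fin.<-irrefl (sym eq))

  ∈-union⁻ : ∀ {m} (Ps : Vec (DirectedPath D) m) {u} → u ∈ unionVertices Ps →
    ∃ λ j → u ∈ pathVertices (lookup Ps j)
  ∈-union⁻ []       u∈ = contradiction u∈ ∉⊥
  ∈-union⁻ (P ∷ Ps) u∈ with x∈p∪q⁻ (pathVertices P) _ u∈
  ... | inj₁ u∈P  = zero , u∈P
  ... | inj₂ u∈Ps with ∈-union⁻ Ps u∈Ps
  ...   | j , u∈Pj = suc j , u∈Pj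

  -- If `m` paths covered `suc m` points of a row, two of these points would lie on the same path by
  -- the pigeonhole principle.
  row-survives : ∀ {m} (Ps : Vec (DirectedPath D) m) {i} (e : Fin (suc m) → Fin n) →
    Injective _≡_ _≡_ e → (∀ c → row (e c) ≡ i) → ∃ λ c → e c ∉ unionVertices Ps
  row-survives Ps e inj inRow with any? (λ c → ¬? (e c ∈? unionVertices Ps))
  ... | yes found = found
  ... | no none   =
    contradiction (inj (path-meets-row-once (lookup Ps (proj₁ (hit c))) (proj₂ (hit c))
      (subst (λ j → e d ∈ pathVertices (lookup Ps j)) (sym same) (proj₂ (hit d)))
      (trans (inRow c) (sym (inRow d))))) (Fin.<⇒≢ c<d)
    where
    hit : ∀ c → ∃ λ j → e c ∈ pathVertices (lookup Ps j)
    hit c = ∈-union⁻ Ps (decidable-stable (e c ∈? _) (λ c∉ → none (c , c∉)))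

    clash = pigeonhole (n<1+n _) (proj₁ ∘ hit)
    c = proj₁ clash
    d = proj₁ (proj₂ clash)
    c<d = proj₁ (proj₂ (proj₂ clash))
    same = proj₂ (proj₂ (proj₂ clash))

theorem1 : (k : ℕ) .{{_ : NonZero k}} →
    Σ ℕ λ n → Σ (Digraph n) λ D →
    HasStabilityNumber D k ×
    ((Ps : Vec (DirectedPath D) (k ∸ 1)) →
    HasStabilityNumber (D ∖ unionVertices Ps) k)
-- There is one colour per column, and the cliques sought have size `suc k`, which `folkman` takes
-- as `k`.
theorem1 (suc k) with folkman (suc k) k
... | t , H , bounded , arrows =
  -- With nothing deleted, the point in column zero serves as the survivor of each row.
  t * suc k , D , ∖-stabilityNumber⇒ bG (stability ∅ λ i → zero , ∉⊥) ,
  λ Ps → stability (unionVertices Ps) λ i →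
    row-survives Ps (combine i) (λ {c} {d} → combine-injectiveʳ i c i d)
      (λ c → cong proj₁ (remQuot-combine i c))
  where
  G : Graph (Fin (t * suc k))
  G = pullback (remQuot (suc k)) (prism H)

  row-clique : ∀ {u v} → quotient (suc k) u ≡ quotient (suc k) v → u ≢ v → Adj G u v
  row-clique {u} {v} eq ne = inj₁ (eq , λ eq′ → ne
    (trans (sym (combine-remQuot {t} (suc k) u)) (trans (cong₂ combine eq eq′) (combine-remQuot {t} (suc k) v))))

  open Layered G (quotient (suc k)) row-clique

  bG : CliqueBounded G (suc k)
  bG = pullback-cliqueBounded _ (prism H) (prism-cliqueBounded H bounded)

  stability : ∀ X → (∀ i → ∃ λ c → combine i c ∉ X) → HasStabilityNumber (D ∖ X) (suc k)
  -- A vertex of `H` is coloured by the column of the surviving point in its row, so the points of a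
  -- clique of colour `c` placed in column `c` all avoid `X`.
  stability X survivor with arrows (proj₁ ∘ survivor)
  ... | c , is , len , cl , mono = ∖-stabilityNumber bG
    ( map (λ i → combine i c) is , trans (length-map _ is) len
    , AllPairs.map⁺ (AllPairs.map (λ {i} {j} a → subst₂ (Adj (prism H))
        (sym (remQuot-combine i c)) (sym (remQuot-combine j c)) (inj₂ (refl , a))) cl)
    , All.map⁺ (All.map (λ {i} eq → subst (λ d → combine i d ∉ X) eq (proj₂ (survivor i))) mono) )
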